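{- Let $f=g+h$ be a polynomial, and $m\geq 2$ an integer, such that every monomial of $g$ has at least $m$ variables, and every monomial of $h$ has fewer than $m/3$ variables. Then there is an integer $r$ with $m/3\le r\le 2m/3$ such that \[ \mathrm{C}_{0/1}(f)\geq \frac{|\mathrm{sup}(g)|}{\#_r(g)\cdot\#_{m-r}(g)}\,. \]
   Context: All polynomials have nonnegative integer coefficients; the monomials of a polynomial are those with nonzero coefficient. The number of variables of a monomial is the number of distinct variables occurring in it with nonzero exponent. The support $\mathrm{sup}(f)$ of a polynomial $f$ is the family of the sets of variables of the monomials of $f$. For a finite family $A$ of finite sets, its $r$-th degree is $\#_r(A)=\max_{|b|=r}|\{a\in A\colon a\supseteq b\}|$, the maximum number of members of $A$ containing a fixed $r$-element set. For a polynomial $g$, $\#_r(g)=\#_r(\mathrm{sup}(g))$. A $\{+,\times\}$-circuit is a directed acyclic graph whose input nodes (fanin $0$) are labelled by variables $x_1,\ldots,x_n$ and whose other nodes, called gates, have fanin two and are labelled $+$ or $\times$; its size is the number of gates. Syntactically (formally, expanding by distributivity) the circuit produces at each node a polynomial: $x_i$ at an input $x_i$, and the sum (product) of the polynomials produced at its two inputs at a $+$ ($\times$) gate. The polynomial $F$ produced by the circuit is the one produced at its output. The circuit counts $f(x_1,\dots,x_n)$ if $F(a)=f(a)$ for all $a\in\{0,1\}^n$. $\mathrm{C}_{0/1}(f)$ denotes the minimum size of a $\{+,\times\}$-circuit counting $f$. -}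

module Defs where

open import Data.Bool.Properties using () renaming (_≟_ to _≟ᵇ_)
open import Data.Fin using (Fin; toℕ)
open import Data.Fin.Subset using (Subset; inside; outside; ∣_∣)
open import Data.Fin.Subset.Properties using (_⊆?_)
open import Data.List as List using (List; []; _∷_; _++_; filter; length; cartesianProductWith; deduplicate)
open import Data.List.Extrema.Nat using (max)
open import Data.Nat using (ℕ; zero; suc; _+_; _*_; _^_; _≤_; _<ᵇ_; _≟_)
open import Data.Nat.ListAction using (sum)
open import Data.Product using (_×_; _,_; proj₁; proj₂; Σ-syntax)
open import Data.Sum using (_⊎_; inj₁; inj₂)
open import Data.Vec as Vec using (Vec; []; _∷_; lookup; replicate; zipWith; _[_]≔_)
open import Data.Vec.Properties using (≡-dec)
open import Relation.Binary.PropositionalEquality using (_≡_)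
open import Relation.Nullary.Decidable using (¬?)

-- A monomial is its exponent vector.
Monomial : ℕ → Set
Monomial n = Vec ℕ n

vars : ∀ {n} → Monomial n → Subset n
vars = Vec.map (0 <ᵇ_)

numVars : ∀ {n} → Monomial n → ℕ
numVars e = ∣ vars e ∣

-- A formal sum of terms (coefficient, monomial). Terms may repeat a monomial
-- or have coefficient 0, so polynomials are compared by _≈_, not by _≡_.
Polynomial : ℕ → Set
Polynomial n = List (ℕ × Monomial n)

coeff : ∀ {n} → Polynomial n → Monomial n → ℕ
coeff p e = sum (List.map proj₁ (filter (λ t → ≡-dec _≟_ (proj₂ t) e) p))

infix 4 _≈_

_≈_ : ∀ {n} → Polynomial n → Polynomial n → Set
p ≈ q = ∀ e → coeff p e ≡ coeff q e

infixl 6 _+ₚ_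
infixl 7 _*ₚ_

_+ₚ_ : ∀ {n} → Polynomial n → Polynomial n → Polynomial n
_+ₚ_ = _++_

_*ₚ_ : ∀ {n} → Polynomial n → Polynomial n → Polynomial n
_*ₚ_ = cartesianProductWith λ (c , d) (c′ , d′) → (c * c′ , zipWith _+_ d d′)

var : ∀ {n} → Fin n → Polynomial n
var {n} i = (1 , replicate n 0 [ i ]≔ 1) ∷ []

evalMonomial : ∀ {n} → Monomial n → Vec ℕ n → ℕ
evalMonomial e a = Vec.foldr′ _*_ 1 (zipWith _^_ a e)

eval : ∀ {n} → Polynomial n → Vec ℕ n → ℕ
eval p a = sum (List.map (λ (c , e) → c * evalMonomial e a) p)

-- All monomials with nonzero coefficient, possibly with repetitions.
monomials : ∀ {n} → Polynomial n → List (Monomial n)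
monomials p = filter (λ e → ¬? (coeff p e ≟ 0)) (List.map proj₂ p)

-- A family of sets is a list of subsets without repetitions.
Family : ℕ → Set
Family n = List (Subset n)

sup : ∀ {n} → Polynomial n → Family n
sup p = deduplicate (≡-dec _≟ᵇ_) (List.map vars (monomials p))

subsets : ∀ n → List (Subset n)
subsets zero    = [] ∷ []
subsets (suc n) = List.map (outside ∷_) (subsets n) ++ List.map (inside ∷_) (subsets n)

-- The base value 0 matters only for r > n, when there is no b with ∣ b ∣ ≡ r.
degree : ∀ {n} → ℕ → Family n → ℕ
degree {n} r A =
  max 0 (List.map (λ b → length (filter (b ⊆?_) A))
                  (filter (λ b → ∣ b ∣ ≟ r) (subsets n)))

#[_] : ∀ {n} → ℕ → Polynomial n → ℕ
#[ r ] g = degree r (sup g)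

data Op : Set where
  plus times : Op

-- A node is an input variable or one of k gates.
Node : ℕ → ℕ → Set
Node n k = Fin n ⊎ Fin k

-- The gates of a directed acyclic graph, listed in a topological order.
-- Gate number 0 is the most recently added one.
data Gates (n : ℕ) : ℕ → Set where
  []   : Gates n 0
  gate : ∀ {k} → Op → Node n k → Node n k → Gates n k → Gates n (suc k)

record Circuit (n : ℕ) : Set where
  constructor circuit
  field
    size   : ℕ
    gates  : Gates n size
    output : Node n size

open Circuit public

atNode : ∀ {n k} → Vec (Polynomial n) k → Node n k → Polynomial n
atNode ps (inj₁ i) = var i
atNode ps (inj₂ j) = lookup ps j

applyOp : ∀ {n} → Op → Polynomial n → Polynomial n → Polynomial n
applyOp plus  = _+ₚ_
applyOp times = _*ₚ_

producedAtGates : ∀ {n k} → Gates n k → Vec (Polynomial n) k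
producedAtGates []              = []
producedAtGates (gate op u v G) =
  let ps = producedAtGates G in applyOp op (atNode ps u) (atNode ps v) ∷ ps

produced : ∀ {n} → Circuit n → Polynomial n
produced C = atNode (producedAtGates (gates C)) (output C)

Counts : ∀ {n} → Circuit n → Polynomial n → Set
Counts {n} C f = (a : Vec (Fin 2) n) →
  eval (produced C) (Vec.map toℕ a) ≡ eval f (Vec.map toℕ a)

-- C₀₁ f ≡ s as a relation. If no circuit counts f (for instance, if f has a
-- nonzero constant term), then no s is related to f, i.e. C₀₁ f is infinite.
IsC₀₁ : ∀ {n} → Polynomial n → ℕ → Set
IsC₀₁ {n} f s =
  (Σ[ C ∈ Circuit n ] Counts C f × size C ≡ s) ×
  (∀ (C : Circuit n) → Counts C f → s ≤ size C)

-- The denominator is cleared; for q = 0 this holds only if p ≡ 0 or C₀₁ f is infinite.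
C₀₁_≥_/_ : ∀ {n} → Polynomial n → ℕ → ℕ → Set
C₀₁ f ≥ p / q = ∀ s → IsC₀₁ f s → p ≤ s * q

{-# OPTIONS --safe #-}

-- By Möbius inversion, a circuit counting f produces a polynomial F with the same
-- support as f. Every S in sup(g) has a parse tree in which the descent into a
-- subtree with more than 2m/3 variables stops at a × gate with a factor having
-- between m/3 and 2m/3 variables, so S = Y ∪ Z ∪ B with Y, Z supported at the two
-- inputs. Charge S to that gate and fix one such factor A₀, of size r, per gate.
-- Replacing the corresponding factor of S by A₀ gives T ⊇ A₀ in sup(F), and T lies
-- in sup(g) because it is too large for h; there are at most #ᵣ(g) such T. Since
-- S ⊇ T ∖ A₀ and |T ∖ A₀| ≥ m − r, at most #ₘ₋ᵣ(g) sets S share the same T. Choosing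
-- r to maximise #ᵣ(g) · #ₘ₋ᵣ(g) makes the bound uniform over the gates.

module Submission where

open import Defs
open import Algebra.Properties.CommutativeSemigroup using (interchange)
open import Data.Bool using (Bool; true; false; if_then_else_)
open import Data.Bool.Properties using () renaming (_≟_ to _≟ᵇ_)
open import Data.Fin using (Fin; zero; suc; toℕ)
open import Data.Fin.Subset using (Subset; inside; outside; ∣_∣; _⊆_; _∪_; _─_; ⊥; ⁅_⁆)
open import Data.Fin.Subset.Properties
  using (_⊆?_; out⊆; s⊆s; p⊆p∪q; q⊆p∪q; ∪-assoc; ∪-comm; ∪-identityʳ; ∣p∣≤∣p∪q∣; ∣⁅x⁆∣≡1)
open import Data.List as List using (List; []; _∷_; length; filter; allFin; upTo)
open import Data.List.Extrema.Nat using (xs≤max; argmax; argmax-all; f[xs]≤f[argmax])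
open import Data.List.Membership.Propositional using (_∈_; lose; find)
open import Data.List.Membership.Propositional.Properties
  using ( ∈-map⁺; ∈-map⁻; ∈-++⁺ˡ; ∈-++⁺ʳ; ∈-filter⁺; ∈-filter⁻; ∈-deduplicate⁺; ∈-deduplicate⁻
        ; ∈-allFin; ∈-upTo⁺; ∈-cartesianProductWith⁻)
open import Data.List.Properties using (length-tabulate)
open import Data.List.Relation.Binary.Sublist.Propositional
  using ([]; _∷_; _∷ʳ_) renaming (_⊆_ to _⊑_)
open import Data.List.Relation.Binary.Sublist.Propositional.Properties using (All-resp-⊆)
open import Data.List.Relation.Unary.All as All using (All; []; _∷_)
open import Data.List.Relation.Unary.All.Properties using (all-filter)
open import Data.List.Relation.Unary.AllPairs using ([]; _∷_)
open import Data.List.Relation.Unary.Any as Any using (Any; here; there)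
import Data.List.Relation.Unary.Any.Properties as Any
open import Data.List.Relation.Unary.Unique.Propositional using (Unique)
open import Data.List.Relation.Unary.Unique.DecPropositional.Properties using (deduplicate-!)
open import Data.Nat
open import Data.Nat.ListAction using (sum)
open import Data.Nat.Properties
open import Data.Product using (_×_; _,_; proj₁; proj₂; ∃-syntax; map₂)
open import Data.Sum using (_⊎_; inj₁; inj₂; [_,_]′)
open import Data.Vec as Vec using (Vec; []; _∷_; here; there)
open import Data.Vec.Properties using (≡-dec)
open import Function using (_∘_; id)
open import Relation.Binary.PropositionalEquality
open import Relation.Nullary using (yes; no; contradiction; _×-dec_)

-- Counting duplicate-free lists by fibres.

module _ {A : Set} where

  -- The sides are selected by a proof of `P x ⊎ Q x` rather than by a decision procedure, since
  -- relations such as `Factored` are not decided here.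
  record Split (P Q : A → Set) (xs : List A) : Set where
    constructor split
    field
      {ys zs} : List A
      ys⊑xs   : ys ⊑ xs
      zs⊑xs   : zs ⊑ xs
      length≡ : length xs ≡ length ys + length zs
      all-ys  : All P ys
      all-zs  : All Q zs

  splitAll : ∀ {P Q : A → Set} {xs} → All (λ x → P x ⊎ Q x) xs → Split P Q xs
  splitAll []         = split [] [] refl [] []
  splitAll {P} {Q} {x ∷ xs} (c ∷ cs) with splitAll cs
  ... | split ys⊑ zs⊑ len ps qs = [ left , right ]′ c
    where
    left : P x → Split P Q (x ∷ xs)
    left p = split (refl ∷ ys⊑) (x ∷ʳ zs⊑) (cong suc len) (p ∷ ps) qs
    right : Q x → Split P Q (x ∷ xs)
    right q = split (x ∷ʳ ys⊑) (refl ∷ zs⊑) (trans (cong suc len) (sym (+-suc _ _))) ps (q ∷ qs)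

  Unique-resp-⊑ : ∀ {xs ys : List A} → ys ⊑ xs → Unique xs → Unique ys
  Unique-resp-⊑ []          []         = []
  Unique-resp-⊑ (_    ∷ʳ τ) (_  ∷ xs!) = Unique-resp-⊑ τ xs!
  Unique-resp-⊑ (refl ∷  τ) (x∉ ∷ xs!) = All-resp-⊆ τ x∉ ∷ Unique-resp-⊑ τ xs!

  -- Union bound: elements whose cover proof picks `y` form a sublist of its fibre, and the tail
  -- covers the rest. An element related to several `y` is counted once.
  length≤-by-fibres : ∀ {B : Set} {R : A → B → Set} {e} {xs : List A} (ys : List B) →
    Unique xs → All (λ x → Any (R x) ys) xs →
    (∀ {y} → y ∈ ys → ∀ {zs} → Unique zs → All (λ z → R z y) zs → length zs ≤ e) →
    length xs ≤ length ys * e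
  length≤-by-fibres []       _   []       _     = z≤n
  length≤-by-fibres []       _   (() ∷ _) _
  length≤-by-fibres (y ∷ ys) xs! cov      fibre with splitAll (All.map Any.toSum cov)
  ... | split ys⊑ zs⊑ len hits misses = ≤-trans (≤-reflexive len) (+-mono-≤
    (fibre (here refl) (Unique-resp-⊑ ys⊑ xs!) hits)
    (length≤-by-fibres ys (Unique-resp-⊑ zs⊑ xs!) misses (fibre ∘ there)))

  Unique⇒length≤ : ∀ {xs ys : List A} → Unique xs → All (_∈ ys) xs → length xs ≤ length ys
  Unique⇒length≤ {ys = ys} xs! xs∈ys =
    ≤-trans (length≤-by-fibres ys xs! xs∈ys (λ _ → singleton)) (≤-reflexive (*-identityʳ _))
    where
    singleton : ∀ {y zs} → Unique zs → All (_≡ y) zs → length zs ≤ 1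
    singleton _                  []                = z≤n
    singleton _                  (_ ∷ [])          = ≤-refl
    singleton ((z≢z′ ∷ _) ∷ _) (refl ∷ refl ∷ _) = contradiction refl z≢z′

-- Cardinalities of finite sets and degrees of a family.

∈-subsets : ∀ {n} (S : Subset n) → S ∈ subsets n
∈-subsets []            = here refl
∈-subsets (outside ∷ S) = ∈-++⁺ˡ (∈-map⁺ _ (∈-subsets S))
∈-subsets (inside  ∷ S) = ∈-++⁺ʳ _ (∈-map⁺ _ (∈-subsets S))

∣p∪q∣≤∣p∣+∣q∣ : ∀ {n} (p q : Subset n) → ∣ p ∪ q ∣ ≤ ∣ p ∣ + ∣ q ∣
∣p∪q∣≤∣p∣+∣q∣ []            []            = z≤n
∣p∪q∣≤∣p∣+∣q∣ (inside  ∷ p) (inside  ∷ q) = s≤s (≤-trans (∣p∪q∣≤∣p∣+∣q∣ p q) (+-monoʳ-≤ ∣ p ∣ (n≤1+n _)))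
∣p∪q∣≤∣p∣+∣q∣ (inside  ∷ p) (outside ∷ q) = s≤s (∣p∪q∣≤∣p∣+∣q∣ p q)
∣p∪q∣≤∣p∣+∣q∣ (outside ∷ p) (inside  ∷ q) =
  ≤-trans (s≤s (∣p∪q∣≤∣p∣+∣q∣ p q)) (≤-reflexive (sym (+-suc ∣ p ∣ _)))
∣p∪q∣≤∣p∣+∣q∣ (outside ∷ p) (outside ∷ q) = ∣p∪q∣≤∣p∣+∣q∣ p q

∣p∣≤∣q∣+∣p─q∣ : ∀ {n} (p q : Subset n) → ∣ p ∣ ≤ ∣ q ∣ + ∣ p ─ q ∣
∣p∣≤∣q∣+∣p─q∣ []            []            = z≤n
∣p∣≤∣q∣+∣p─q∣ (inside  ∷ p) (inside  ∷ q) = s≤s (∣p∣≤∣q∣+∣p─q∣ p q)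
∣p∣≤∣q∣+∣p─q∣ (inside  ∷ p) (outside ∷ q) =
  ≤-trans (s≤s (∣p∣≤∣q∣+∣p─q∣ p q)) (≤-reflexive (sym (+-suc ∣ q ∣ _)))
∣p∣≤∣q∣+∣p─q∣ (outside ∷ p) (inside  ∷ q) = ≤-trans (∣p∣≤∣q∣+∣p─q∣ p q) (n≤1+n _)
∣p∣≤∣q∣+∣p─q∣ (outside ∷ p) (outside ∷ q) = ∣p∣≤∣q∣+∣p─q∣ p q

p∪q─p⊆q : ∀ {n} (p q : Subset n) → (p ∪ q) ─ p ⊆ q
p∪q─p⊆q (outside ∷ p) (inside ∷ q) here      = here
p∪q─p⊆q (outside ∷ p) (_      ∷ q) (there i) = there (p∪q─p⊆q p q i)
p∪q─p⊆q (inside  ∷ p) (_      ∷ q) (there i) = there (p∪q─p⊆q p q i)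

subset-of-size : ∀ {n} k (p : Subset n) → k ≤ ∣ p ∣ → ∃[ q ] q ⊆ p × ∣ q ∣ ≡ k
subset-of-size zero    []            _ = [] , id , refl
subset-of-size k       (outside ∷ p) k≤ with q , q⊆p , ∣q∣≡k ← subset-of-size k p k≤ =
  outside ∷ q , out⊆ q⊆p , ∣q∣≡k
subset-of-size zero    (inside  ∷ p) _ with q , q⊆p , ∣q∣≡0 ← subset-of-size zero p z≤n =
  outside ∷ q , out⊆ q⊆p , ∣q∣≡0
subset-of-size (suc k) (inside  ∷ p) (s≤s k≤) with q , q⊆p , ∣q∣≡k ← subset-of-size k p k≤ =
  inside ∷ q , s⊆s q⊆p , cong suc ∣q∣≡k

length-filter-⊇≤degree : ∀ {n} (A : Family n) (b : Subset n) →
  length (filter (b ⊆?_) A) ≤ degree ∣ b ∣ A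
length-filter-⊇≤degree A b = All.lookup (xs≤max 0 _)
  (∈-map⁺ (λ b → length (filter (b ⊆?_) A)) (∈-filter⁺ (λ c → ∣ c ∣ ≟ ∣ b ∣) (∈-subsets b) refl))

-- For r = ∣ A₀ ∣: there are at most #ᵣ(A) such T, and all S with the same T share
-- an (m ∸ r)-element subset of T ─ A₀.
length≤degree*degree : ∀ {n m} {A : Family n} (A₀ : Subset n) →
  All (λ T → m ≤ ∣ T ∣) A →
  ∀ {L} → Unique L →
  All (λ S → S ∈ A × ∃[ T ] T ∈ A × A₀ ⊆ T × T ─ A₀ ⊆ S) L →
  length L ≤ degree ∣ A₀ ∣ A * degree (m ∸ ∣ A₀ ∣) A
length≤degree*degree {m = m} {A} A₀ large {L} L! hyp = ≤-trans
  -- The relation includes `S ∈ A` so that `fibre` can place its members in the filtered family.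
  (length≤-by-fibres {R = λ S T → S ∈ A × T ─ A₀ ⊆ S} (filter (A₀ ⊆?_) A) L! (All.map covered hyp) fibre)
  (*-monoˡ-≤ _ (length-filter-⊇≤degree A A₀))
  where
  covered : ∀ {S} → S ∈ A × (∃[ T ] T ∈ A × A₀ ⊆ T × T ─ A₀ ⊆ S) →
            Any (λ T → S ∈ A × T ─ A₀ ⊆ S) (filter (A₀ ⊆?_) A)
  covered (S∈A , T , T∈A , A₀⊆T , T─A₀⊆S) =
    lose (∈-filter⁺ (A₀ ⊆?_) T∈A A₀⊆T) (S∈A , λ {x} → T─A₀⊆S {x})
  fibre : ∀ {T} → T ∈ filter (A₀ ⊆?_) A → ∀ {zs} → Unique zs →
          All (λ S → S ∈ A × T ─ A₀ ⊆ S) zs → length zs ≤ degree (m ∸ ∣ A₀ ∣) A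
  fibre {T} T∈ {zs} zs! all
    with b , b⊆ , ∣b∣≡ ← subset-of-size (m ∸ ∣ A₀ ∣) (T ─ A₀)
           (m≤n+o⇒m∸n≤o m ∣ A₀ ∣
             (≤-trans (All.lookup large (proj₁ (∈-filter⁻ (A₀ ⊆?_) {xs = A} T∈))) (∣p∣≤∣q∣+∣p─q∣ T A₀)))
    = subst (λ k → length zs ≤ degree k A) ∣b∣≡ (≤-trans
        (Unique⇒length≤ zs! (All.map
          (λ (S∈A , T─A₀⊆S) → ∈-filter⁺ (b ⊆?_) S∈A (λ {x} x∈b → T─A₀⊆S {x} (b⊆ x∈b))) all))
        (length-filter-⊇≤degree A b))

-- Variable sets of monomials.

-- Stated for single terms, so that it passes through sums and products termwise. Natural
-- coefficients cannot cancel, hence it agrees with `S ∈ sup p`.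
Supports : ∀ {n} → Polynomial n → Subset n → Set
Supports p S = Any (λ (c , e) → c ≢ 0 × vars e ≡ S) p

vars-+ : ∀ {n} (d e : Monomial n) → vars (Vec.zipWith _+_ d e) ≡ vars d ∪ vars e
vars-+ []          []          = refl
vars-+ (zero  ∷ d) (x     ∷ e) = cong (_ ∷_) (vars-+ d e)
vars-+ (suc _ ∷ d) (x     ∷ e) = cong (true ∷_) (vars-+ d e)

vars-replicate-0 : ∀ n → vars (Vec.replicate n 0) ≡ ⊥
vars-replicate-0 zero    = refl
vars-replicate-0 (suc n) = cong (outside ∷_) (vars-replicate-0 n)

vars-var : ∀ {n} (i : Fin n) → vars (Vec.replicate n 0 Vec.[ i ]≔ 1) ≡ ⁅ i ⁆
vars-var {suc n} zero    = cong (inside ∷_) (vars-replicate-0 n)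
vars-var         (suc i) = cong (outside ∷_) (vars-var i)

Supports-var⁻ : ∀ {n} (i : Fin n) {S} → Supports (var i) S → ∣ S ∣ ≡ 1
Supports-var⁻ i (here (_ , refl)) = trans (cong ∣_∣ (vars-var i)) (∣⁅x⁆∣≡1 i)

Supports-*⁺ : ∀ {n} (p q : Polynomial n) {S T} → Supports p S → Supports q T → Supports (p *ₚ q) (S ∪ T)
Supports-*⁺ p q S∈p T∈q = Any.cartesianProductWith⁺ _
  (λ { {c , d} {c′ , d′} (c≢0 , refl) (c′≢0 , refl) →
       ([ c≢0 , c′≢0 ]′ ∘ m*n≡0⇒m≡0∨n≡0 c) , vars-+ d d′ })
  S∈p T∈q

Supports-*⁻ : ∀ {n} (p q : Polynomial n) {S} → Supports (p *ₚ q) S →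
  ∃[ Y ] ∃[ Z ] Supports p Y × Supports q Z × Y ∪ Z ≡ S
Supports-*⁻ p q S∈pq with find S∈pq
... | t , t∈ , cc′≢0 , refl with ∈-cartesianProductWith⁻ _ p q t∈
...   | (c , d) , (c′ , d′) , d∈p , d′∈q , refl =
  vars d , vars d′ ,
  lose d∈p ((λ c≡0 → cc′≢0 (cong (_* c′) c≡0)) , refl) ,
  lose d′∈q ((λ c′≡0 → cc′≢0 (trans (cong (c *_) c′≡0) (*-zeroʳ c))) , refl) ,
  sym (vars-+ d d′)

HasMonomial : ∀ {n} → Polynomial n → Monomial n → Set
HasMonomial p e = Any (λ (c , d) → c ≢ 0 × d ≡ e) p

coeff≢0⇒HasMonomial : ∀ {n} (p : Polynomial n) {e} → coeff p e ≢ 0 → HasMonomial p e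
coeff≢0⇒HasMonomial []            p≢0 = contradiction refl p≢0
coeff≢0⇒HasMonomial ((c , d) ∷ p) {e} p≢0 with ≡-dec _≟_ d e | c ≟ 0
... | no  _   | _        = there (coeff≢0⇒HasMonomial p p≢0)
... | yes d≡e | no  c≢0  = here (c≢0 , d≡e)
... | yes d≡e | yes refl = there (coeff≢0⇒HasMonomial p p≢0)

HasMonomial⇒coeff≢0 : ∀ {n} (p : Polynomial n) {e} → HasMonomial p e → coeff p e ≢ 0
HasMonomial⇒coeff≢0 ((c , d) ∷ p) {e} e∈p with ≡-dec _≟_ d e | e∈p
... | yes _   | here (c≢0 , _)  = c≢0 ∘ m+n≡0⇒m≡0 c
... | yes _   | there e∈p′      = HasMonomial⇒coeff≢0 p e∈p′ ∘ m+n≡0⇒n≡0 c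
... | no  d≢e | here (_ , d≡e)  = contradiction d≡e d≢e
... | no  _   | there e∈p′      = HasMonomial⇒coeff≢0 p e∈p′

Supports⇒coeff≢0 : ∀ {n} (p : Polynomial n) {S} → Supports p S → ∃[ e ] coeff p e ≢ 0 × vars e ≡ S
Supports⇒coeff≢0 p S∈p with find S∈p
... | (c , e) , e∈p , c≢0 , refl = e , HasMonomial⇒coeff≢0 p (lose e∈p (c≢0 , refl)) , refl

coeff≢0⇒Supports : ∀ {n} (p : Polynomial n) {e} → coeff p e ≢ 0 → Supports p (vars e)
coeff≢0⇒Supports p p≢0 = Any.map (map₂ (cong vars)) (coeff≢0⇒HasMonomial p p≢0)

Supports-resp-≈ : ∀ {n} (p q : Polynomial n) → p ≈ q → ∀ {S} → Supports p S → Supports q S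
Supports-resp-≈ p q p≈q S∈p with Supports⇒coeff≢0 p S∈p
... | e , p≢0 , refl = coeff≢0⇒Supports q (p≢0 ∘ trans (p≈q e))

Supports⇒∈-monomials : ∀ {n} (p : Polynomial n) {S} → Supports p S → ∃[ e ] e ∈ monomials p × vars e ≡ S
Supports⇒∈-monomials p S∈p with find S∈p
... | (c , e) , e∈p , c≢0 , refl = e ,
  ∈-filter⁺ _ (∈-map⁺ proj₂ e∈p) (HasMonomial⇒coeff≢0 p (lose e∈p (c≢0 , refl))) , refl

Supports⇒∈-sup : ∀ {n} (p : Polynomial n) {S} → Supports p S → S ∈ sup p
Supports⇒∈-sup p S∈p with Supports⇒∈-monomials p S∈p
... | e , e∈ , refl = ∈-deduplicate⁺ _ (∈-map⁺ vars e∈)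

∈-sup⇒Supports : ∀ {n} (p : Polynomial n) {S} → S ∈ sup p → Supports p S
∈-sup⇒Supports p S∈ with ∈-map⁻ vars (∈-deduplicate⁻ _ (List.map vars (monomials p)) S∈)
... | e , e∈ , refl = coeff≢0⇒Supports p (proj₂ (∈-filter⁻ _ {xs = List.map proj₂ p} e∈))

sup-Unique : ∀ {n} (p : Polynomial n) → Unique (sup p)
sup-Unique p = deduplicate-! (≡-dec _≟ᵇ_) (List.map vars (monomials p))

-- Möbius inversion: values at 0/1 points determine the support.

eq le : Bool → Bool → ℕ
eq false false = 1
eq false true  = 0
eq true  false = 0
eq true  true  = 1
le false _     = 1
le true  s     = eq true s

-- With `eq` this is the delta function, with `le` the zeta function of the subset lattice.
match : ∀ {n} → (Bool → Bool → ℕ) → Subset n → Subset n → ℕ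
match δ []      []      = 1
match δ (x ∷ X) (s ∷ S) = δ x s * match δ X S

-- The total coefficient of the terms matching S: of those with variable set S if
-- δ is eq, and of those with variable set contained in S if δ is le.
weight : ∀ {n} → (Bool → Bool → ℕ) → List (ℕ × Subset n) → Subset n → ℕ
weight δ ts S = sum (List.map (λ (c , X) → c * match δ X S) ts)

slice : ∀ {n} → Bool → List (ℕ × Subset (suc n)) → List (ℕ × Subset n)
slice b = List.map λ (c , X) → c * eq (Vec.head X) b , Vec.tail X

weight-eq-∷ : ∀ {n} b (ts : List (ℕ × Subset (suc n))) S →
  weight eq ts (b ∷ S) ≡ weight eq (slice b ts) S
weight-eq-∷ b []                 S = refl
weight-eq-∷ b ((c , x ∷ X) ∷ ts) S =
  cong₂ _+_ (sym (*-assoc c (eq x b) (match eq X S))) (weight-eq-∷ b ts S)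

weight-le-outside : ∀ {n} (ts : List (ℕ × Subset (suc n))) S →
  weight le ts (outside ∷ S) ≡ weight le (slice outside ts) S
weight-le-outside []                 S = refl
weight-le-outside ((c , x ∷ X) ∷ ts) S = cong₂ _+_
  (trans (cong (λ d → c * (d * match le X S)) (le-outside x)) (sym (*-assoc c (eq x outside) (match le X S))))
  (weight-le-outside ts S)
  where
  le-outside : ∀ x → le x outside ≡ eq x outside
  le-outside false = refl
  le-outside true  = refl

weight-le-inside : ∀ {n} (ts : List (ℕ × Subset (suc n))) S →
  weight le ts (inside ∷ S) ≡ weight le (slice outside ts) S + weight le (slice inside ts) S
weight-le-inside []                 S = refl
weight-le-inside ((c , x ∷ X) ∷ ts) S = begin
  c * (le x inside * M) + weight le ts (inside ∷ S)
    ≡⟨ cong₂ _+_ (term x) (weight-le-inside ts S) ⟩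
  (c * eq x outside * M + c * eq x inside * M) + (W₀ + W₁)
    ≡⟨ interchange +-commutativeSemigroup (c * eq x outside * M) (c * eq x inside * M) W₀ W₁ ⟩
  (c * eq x outside * M + W₀) + (c * eq x inside * M + W₁) ∎
  where
  open ≡-Reasoning
  M  = match le X S
  W₀ = weight le (slice outside ts) S
  W₁ = weight le (slice inside ts) S
  term : ∀ x → c * (le x inside * M) ≡ c * eq x outside * M + c * eq x inside * M
  term false rewrite *-zeroʳ c | *-identityʳ c | +-identityʳ M = sym (+-identityʳ (c * M))
  term true  rewrite *-zeroʳ c | *-identityʳ c | +-identityʳ M = refl

weight-[] : ∀ (ts : List (ℕ × Subset 0)) → weight eq ts [] ≡ weight le ts []
weight-[] []              = refl
weight-[] ((c , []) ∷ ts) = cong (c * 1 +_) (weight-[] ts)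

-- Möbius inversion over the subset lattice, one coordinate at a time.
weight-le⇒weight-eq : ∀ {n} (ts us : List (ℕ × Subset n)) →
  (∀ S → weight le ts S ≡ weight le us S) → ∀ S → weight eq ts S ≡ weight eq us S
weight-le⇒weight-eq ts us ts≗us [] = trans (weight-[] ts) (trans (ts≗us []) (sym (weight-[] us)))
weight-le⇒weight-eq ts us ts≗us (b ∷ S) = begin
  weight eq ts (b ∷ S)      ≡⟨ weight-eq-∷ b ts S ⟩
  weight eq (slice b ts) S  ≡⟨ weight-le⇒weight-eq (slice b ts) (slice b us) (slices b) S ⟩
  weight eq (slice b us) S  ≡⟨ weight-eq-∷ b us S ⟨
  weight eq us (b ∷ S)      ∎
  where
  open ≡-Reasoning
  slices : ∀ b S → weight le (slice b ts) S ≡ weight le (slice b us) S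
  slices false S = trans (sym (weight-le-outside ts S)) (trans (ts≗us (outside ∷ S)) (weight-le-outside us S))
  -- Cancelling the common `outside` part replaces the subtraction of Möbius inversion within the
  -- natural numbers.
  slices true  S = +-cancelˡ-≡ (weight le (slice outside ts) S) _ _ (begin
    weight le (slice outside ts) S + weight le (slice inside ts) S  ≡⟨ weight-le-inside ts S ⟨
    weight le ts (inside ∷ S)                                       ≡⟨ ts≗us (inside ∷ S) ⟩
    weight le us (inside ∷ S)                                       ≡⟨ weight-le-inside us S ⟩
    weight le (slice outside us) S + weight le (slice inside us) S  ≡⟨ cong (_+ weight le (slice inside us) S) (slices false S) ⟨
    weight le (slice outside ts) S + weight le (slice inside us) S  ∎)

match-eq≢0 : ∀ {n} (X S : Subset n) → match eq X S ≢ 0 → X ≡ S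
match-eq≢0 []          []          _  = refl
match-eq≢0 (false ∷ X) (false ∷ S) m≢0 = cong (false ∷_) (match-eq≢0 X S (m≢0 ∘ trans (+-identityʳ _)))
match-eq≢0 (false ∷ X) (true  ∷ S) m≢0 = contradiction refl m≢0
match-eq≢0 (true  ∷ X) (false ∷ S) m≢0 = contradiction refl m≢0
match-eq≢0 (true  ∷ X) (true  ∷ S) m≢0 = cong (true ∷_) (match-eq≢0 X S (m≢0 ∘ trans (+-identityʳ _)))

match-eq-refl : ∀ {n} (S : Subset n) → match eq S S ≡ 1
match-eq-refl []          = refl
match-eq-refl (false ∷ S) = trans (+-identityʳ _) (match-eq-refl S)
match-eq-refl (true  ∷ S) = trans (+-identityʳ _) (match-eq-refl S)

varSets : ∀ {n} → Polynomial n → List (ℕ × Subset n)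
varSets = List.map (map₂ vars)

Supports⇒weight≢0 : ∀ {n} (p : Polynomial n) {S} → Supports p S → weight eq (varSets p) S ≢ 0
Supports⇒weight≢0 ((c , e) ∷ p) (here (c≢0 , refl)) w≡0 = c≢0 (begin
  c                             ≡⟨ *-identityʳ c ⟨
  c * 1                         ≡⟨ cong (c *_) (match-eq-refl (vars e)) ⟨
  c * match eq (vars e) (vars e)  ≡⟨ m+n≡0⇒m≡0 _ w≡0 ⟩
  0                             ∎)
  where open ≡-Reasoning
Supports⇒weight≢0 ((c , e) ∷ p) (there S∈p) w≡0 =
  Supports⇒weight≢0 p S∈p (m+n≡0⇒n≡0 (c * match eq (vars e) _) w≡0)

weight≢0⇒Supports : ∀ {n} (p : Polynomial n) {S} → weight eq (varSets p) S ≢ 0 → Supports p S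
weight≢0⇒Supports []            w≢0 = contradiction refl w≢0
weight≢0⇒Supports ((c , e) ∷ p) {S} w≢0 with c * match eq (vars e) S ≟ 0
... | yes t≡0 = there (weight≢0⇒Supports p (w≢0 ∘ cong₂ _+_ t≡0))
... | no  t≢0 = here
  ( (λ c≡0 → t≢0 (cong (_* match eq (vars e) S) c≡0))
  , match-eq≢0 (vars e) S (λ m≡0 → t≢0 (trans (cong (c *_) m≡0) (*-zeroʳ c))))

indicator : ∀ {n} → Subset n → Vec (Fin 2) n
indicator = Vec.map λ b → if b then suc zero else zero

-- A positive power of 0 or 1 equals its base, so the monomial evaluates to 1 exactly when its
-- variables lie in `S`.
evalMonomial-indicator : ∀ {n} (e : Monomial n) S →
  evalMonomial e (Vec.map toℕ (indicator S)) ≡ match le (vars e) S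
evalMonomial-indicator []          []          = refl
evalMonomial-indicator (zero  ∷ e) (s     ∷ S) = cong (1 *_) (evalMonomial-indicator e S)
evalMonomial-indicator (suc _ ∷ e) (false ∷ S) = refl
evalMonomial-indicator (suc x ∷ e) (true  ∷ S) =
  cong₂ _*_ (^-zeroˡ (suc x)) (evalMonomial-indicator e S)

eval-indicator : ∀ {n} (p : Polynomial n) S →
  eval p (Vec.map toℕ (indicator S)) ≡ weight le (varSets p) S
eval-indicator []            S = refl
eval-indicator ((c , e) ∷ p) S = cong₂ _+_ (cong (c *_) (evalMonomial-indicator e S)) (eval-indicator p S)

-- Values at indicators are the `le` weights; inversion turns them into `eq` weights, which are
-- nonzero exactly at supported sets because nothing cancels. Individual coefficients and exponents
-- may still differ.
Supports-resp-eval : ∀ {n} (p q : Polynomial n) →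
  (∀ (a : Vec (Fin 2) n) → eval p (Vec.map toℕ a) ≡ eval q (Vec.map toℕ a)) →
  ∀ {S} → Supports p S → Supports q S
Supports-resp-eval p q p≗q {S} S∈p = weight≢0⇒Supports q (Supports⇒weight≢0 p S∈p ∘ trans
  (weight-le⇒weight-eq (varSets p) (varSets q)
    (λ S → trans (sym (eval-indicator p S)) (trans (p≗q (indicator S)) (eval-indicator q S))) S))

-- Descent to a × gate with a middle-third factor.

factors : ∀ {n k} → Gates n k → Fin k → Polynomial n × Polynomial n
factors (gate _ u v G) zero    = atNode (producedAtGates G) u , atNode (producedAtGates G) v
factors (gate _ _ _ G) (suc j) = factors G j

InMiddleThird : ℕ → ℕ → Set
InMiddleThird m r = m ≤ 3 * r × 3 * r ≤ 2 * m

-- B stands for the rest of the parse tree of S outside the × gate with inputs p and q.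
Factored : ∀ {n} → (Subset n → Set) → ℕ → Polynomial n × Polynomial n → Subset n → Set
Factored Target m (p , q) S = ∃[ Y ] ∃[ Z ] ∃[ B ]
  Supports p Y × Supports q Z × (Y ∪ Z) ∪ B ≡ S ×
  (∀ {Y′ Z′} → Supports p Y′ → Supports q Z′ → Target ((Y′ ∪ Z′) ∪ B)) ×
  (InMiddleThird m ∣ Y ∣ ⊎ InMiddleThird m ∣ Z ∣)

-- Two parts both below m/3 would have sum at most 2m/3.
larger-part : ∀ {m} y z → 2 * m < 3 * (y + z) → 3 * y ≤ 2 * m → 3 * z ≤ 2 * m →
              InMiddleThird m y ⊎ InMiddleThird m z
larger-part {m} y z 2m<3[y+z] 3y≤2m 3z≤2m with m ≤? 3 * y | m ≤? 3 * z
... | yes m≤3y | _        = inj₁ (m≤3y , 3y≤2m)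
... | no  _    | yes m≤3z = inj₂ (m≤3z , 3z≤2m)
... | no  m≰3y | no  m≰3z = contradiction 2m<3[y+z] (≤⇒≯ (begin
  3 * (y + z)    ≡⟨ *-distribˡ-+ 3 y z ⟩
  3 * y + 3 * z  ≤⟨ +-mono-≤ (≰⇒≥ m≰3y) (≰⇒≥ m≰3z) ⟩
  m + m          ≡⟨ cong (m +_) (+-identityʳ m) ⟨
  2 * m          ∎))
  where open ≤-Reasoning

∪-swap : ∀ {n} (Y Z B : Subset n) → Z ∪ (Y ∪ B) ≡ (Y ∪ Z) ∪ B
∪-swap Y Z B = trans (sym (∪-assoc Z Y B)) (cong (_∪ B) (∪-comm Z Y))

-- `B` collects the variables of the factors left behind on the way to `w`. The invariant is that
-- every set supported at `w` completes with `B` to a target, so an exchange made deep in the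
-- circuit remains valid at its output.
descend : ∀ {n k m} (Target : Subset n → Set) → 2 ≤ m →
  (G : Gates n k) (w : Node n k) {X B : Subset n} →
  Supports (atNode (producedAtGates G) w) X →
  (∀ {X′} → Supports (atNode (producedAtGates G) w) X′ → Target (X′ ∪ B)) →
  2 * m < 3 * ∣ X ∣ →
  ∃[ j ] Factored Target m (factors G j) (X ∪ B)
-- An input has one variable, and 3 ≤ 4 ≤ 2m since m ≥ 2, so it never exceeds 2m/3.
descend Target 2≤m G (inj₁ i) X∈w _ big = contradiction big (≤⇒≯ (≤-trans
  (≤-reflexive (cong (3 *_) (Supports-var⁻ i X∈w))) (≤-trans (n≤1+n 3) (*-monoʳ-≤ 2 2≤m))))
descend Target 2≤m (gate _ _ _ G) (inj₂ (suc j)) X∈w ext big with descend Target 2≤m G (inj₂ j) X∈w ext big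
... | i , fac = suc i , fac
descend Target 2≤m (gate plus u v G) (inj₂ zero) X∈w ext big
  with Any.++⁻ (atNode (producedAtGates G) u) X∈w
... | inj₁ X∈u with i , fac ← descend Target 2≤m G u X∈u (λ X′∈u → ext (Any.++⁺ˡ X′∈u)) big = suc i , fac
... | inj₂ X∈v with i , fac ← descend Target 2≤m G v X∈v (λ X′∈v → ext (Any.++⁺ʳ _ X′∈v)) big = suc i , fac
descend {m = m} Target 2≤m (gate times u v G) (inj₂ zero) {B = B} X∈w ext big
  with Supports-*⁻ (atNode (producedAtGates G) u) (atNode (producedAtGates G) v) X∈w
... | Y , Z , Y∈u , Z∈v , refl with 2 * m <? 3 * ∣ Y ∣ | 2 * m <? 3 * ∣ Z ∣
-- The sibling's set joins the context, which becomes `Z ∪ B`.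
...   | yes bigY | _ with i , fac ← descend Target 2≤m G u Y∈u
          (λ {X′} X′∈u → subst Target (∪-assoc X′ Z B) (ext (Supports-*⁺ _ _ X′∈u Z∈v))) bigY
        = suc i , subst (Factored Target m (factors G i)) (sym (∪-assoc Y Z B)) fac
...   | no _ | yes bigZ with i , fac ← descend Target 2≤m G v Z∈v
          (λ {X′} X′∈v → subst Target (sym (∪-swap Y X′ B)) (ext (Supports-*⁺ _ _ Y∈u X′∈v))) bigZ
        = suc i , subst (Factored Target m (factors G i)) (∪-swap Y Z B) fac
...   | no smallY | no smallZ = zero , Y , Z , B , Y∈u , Z∈v , refl ,
        (λ Y′∈u Z′∈v → ext (Supports-*⁺ _ _ Y′∈u Z′∈v)) ,
        -- `Y` and `Z` may share variables, so only subadditivity is available.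
        larger-part ∣ Y ∣ ∣ Z ∣ (<-≤-trans big (*-monoʳ-≤ 3 (∣p∪q∣≤∣p∣+∣q∣ Y Z))) (≮⇒≥ smallY) (≮⇒≥ smallZ)

-- Counting the sets charged to the gates.

-- The fixed factor is `Y₀` or `Z₀` of the first member of `L`, whichever lies in the middle third.
-- All members are exchanged on that side, even those whose own middle-third factor is on the other.
-- Its size varies with the gate, hence `M` bounds all admissible `r`.
Factored-bound : ∀ {n m M} {A : Family n} {Target : Subset n → Set} →
  All (λ T → m ≤ ∣ T ∣) A →
  (∀ {T} → Target T → m ≤ 3 * ∣ T ∣ → T ∈ A) →
  (∀ r → InMiddleThird m r → degree r A * degree (m ∸ r) A ≤ M) →
  ∀ pq {L} → Unique L → All (λ S → S ∈ A × Factored Target m pq S) L → length L ≤ M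
Factored-bound _ _ _ _ _ [] = z≤n
Factored-bound {n} {m} {M} {A} {Target} large target⇒A ≤M (p , q) {L} L! 
  facs@((_ , Y₀ , Z₀ , _ , Y₀∈p , Z₀∈q , _ , _ , middle) ∷ _) =
  [ (λ mid → bound Y₀ mid (All.map (viaY mid) facs))
  , (λ mid → bound Z₀ mid (All.map (viaZ mid) facs)) ]′ middle
  where
  Rectangle : Subset n → Subset n → Set
  Rectangle A₀ S = S ∈ A × ∃[ T ] T ∈ A × A₀ ⊆ T × T ─ A₀ ⊆ S

  bound : ∀ A₀ → InMiddleThird m ∣ A₀ ∣ → All (Rectangle A₀) L → length L ≤ M
  bound A₀ mid rects = ≤-trans (length≤degree*degree A₀ large L! rects) (≤M ∣ A₀ ∣ mid)

  -- `C` is the other factor of `S` together with `B`. The m/3 variables of `A₀` alone already put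
  -- `A₀ ∪ C` into `A`, and removing `A₀` leaves a subset of `C`.
  rectangle : ∀ {A₀ C S} → InMiddleThird m ∣ A₀ ∣ → S ∈ A → Target (A₀ ∪ C) → C ⊆ S → Rectangle A₀ S
  rectangle {A₀} {C} (m≤ , _) S∈A t C⊆S = S∈A , A₀ ∪ C ,
    target⇒A t (≤-trans m≤ (*-monoʳ-≤ 3 (∣p∣≤∣p∪q∣ A₀ C))) ,
    p⊆p∪q C , λ x∈ → C⊆S (p∪q─p⊆q A₀ C x∈)

  viaY : InMiddleThird m ∣ Y₀ ∣ → ∀ {S} → S ∈ A × Factored Target m (p , q) S → Rectangle Y₀ S
  viaY mid (S∈A , Y , Z , B , Y∈p , Z∈q , refl , target , _) = rectangle {C = Z ∪ B} mid S∈A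
    (subst Target (∪-assoc Y₀ Z B) (target Y₀∈p Z∈q))
    (subst (Z ∪ B ⊆_) (sym (∪-assoc Y Z B)) (q⊆p∪q Y (Z ∪ B)))

  viaZ : InMiddleThird m ∣ Z₀ ∣ → ∀ {S} → S ∈ A × Factored Target m (p , q) S → Rectangle Z₀ S
  viaZ mid (S∈A , Y , Z , B , Y∈p , Z∈q , refl , target , _) = rectangle {C = Y ∪ B} mid S∈A
    (subst Target (sym (∪-swap Y Z₀ B)) (target Y∈p Z₀∈q))
    (subst (Y ∪ B ⊆_) (∪-swap Y Z B) (q⊆p∪q Z (Y ∪ B)))

length≤size : ∀ {n m M} {A : Family n} (C : Circuit n) → 2 ≤ m →
  Unique A → All (λ T → m ≤ ∣ T ∣) A →
  (∀ {S} → S ∈ A → Supports (produced C) S) →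
  (∀ {T} → Supports (produced C) T → m ≤ 3 * ∣ T ∣ → T ∈ A) →
  (∀ r → InMiddleThird m r → degree r A * degree (m ∸ r) A ≤ M) →
  length A ≤ size C * M
length≤size {n} {m} {M} {A} C 2≤m A! large A⇒C C⇒A ≤M =
  subst (λ k → length A ≤ k * M) (length-tabulate {n = size C} id)
    (length≤-by-fibres {R = λ S j → S ∈ A × FactoredAt S j} (allFin (size C)) A!
      (All.tabulate λ S∈A → let j , fac = gateOf S∈A in lose (∈-allFin j) (S∈A , fac))
      (λ {j} _ → Factored-bound large C⇒A ≤M (factors (gates C) j)))
  where
  Target : Subset n → Set
  Target = Supports (produced C)
  FactoredAt : Subset n → Fin (size C) → Set
  FactoredAt S j = Factored Target m (factors (gates C) j) S
  2m<3∣S∣ : ∀ {S} → S ∈ A → 2 * m < 3 * ∣ S ∣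
  2m<3∣S∣ S∈A = <-≤-trans
    (*-monoˡ-< m {{>-nonZero (<⇒≤ 2≤m)}} (n<1+n 2)) (*-monoʳ-≤ 3 (All.lookup large S∈A))
  gateOf : ∀ {S} → S ∈ A → ∃[ j ] FactoredAt S j
  -- At the output nothing has been left behind, so the context starts as `⊥`.
  gateOf {S} S∈A with j , fac ← descend Target 2≤m (gates C) (output C) {B = ⊥} (A⇒C S∈A)
                                  (λ {X} → subst Target (sym (∪-identityʳ X))) (2m<3∣S∣ S∈A)
    = j , subst (Factored Target m (factors (gates C) j)) (∪-identityʳ S) fac

-- Choosing r and assembling the bound.

-- Raising m by 2 and r by 1 adds 2, 3 and 4 to m, 3r and 2m, preserving both inequalities; 2 and 3
-- start the two parity classes.
∃-InMiddleThird : ∀ m → 2 ≤ m → ∃[ r ] InMiddleThird m r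
∃-InMiddleThird 1                         (s≤s ())
∃-InMiddleThird 2                         _ = 1 , n≤1+n 2 , n≤1+n 3
∃-InMiddleThird 3                         _ = 1 , ≤-refl , m≤m+n 3 3
∃-InMiddleThird (suc (suc m@(suc (suc _)))) _ with r , m≤3r , 3r≤2m ← ∃-InMiddleThird m (s≤s (s≤s z≤n)) =
  suc r ,
  ≤-trans (+-mono-≤ (n≤1+n 2) m≤3r) (≤-reflexive (sym (*-suc 3 r))) ,
  (begin
    3 * suc r    ≡⟨ *-suc 3 r ⟩
    3 + 3 * r    ≤⟨ +-mono-≤ (n≤1+n 3) 3r≤2m ⟩
    4 + 2 * m    ≡⟨ *-distribˡ-+ 2 2 m ⟨
    2 * (2 + m)  ∎)
  where open ≤-Reasoning

argmax-InMiddleThird : ∀ m → 2 ≤ m → (φ : ℕ → ℕ) →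
  ∃[ r ] InMiddleThird m r × (∀ r′ → InMiddleThird m r′ → φ r′ ≤ φ r)
argmax-InMiddleThird m 2≤m φ with r₀ , mid₀ ← ∃-InMiddleThird m 2≤m =
  -- `r₀` is the default value of `argmax`, so it must itself lie in the middle third.
  argmax φ r₀ candidates ,
  argmax-all φ mid₀ (all-filter middle? (upTo (suc m))) ,
  λ r mid → All.lookup (f[xs]≤f[argmax] {f = φ} r₀ candidates)
    -- The list from 0 to m contains every admissible `r`: 3r ≤ 2m ≤ 3m gives r ≤ m.
    (∈-filter⁺ middle? (∈-upTo⁺ (s≤s (*-cancelˡ-≤ 3 (≤-trans (proj₂ mid) (*-monoˡ-≤ m (n≤1+n 2)))))) mid)
  where
  middle? = λ r → (m ≤? 3 * r) ×-dec (3 * r ≤? 2 * m)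
  candidates = filter middle? (upTo (suc m))

theorem8 : ∀ (n : ℕ) (f g h : Polynomial n) (m : ℕ)
    → f ≈ g +ₚ h
    → 2 ≤ m
    → All (λ e → m ≤ numVars e) (monomials g)
    → All (λ e → 3 * numVars e < m) (monomials h)
    → ∃[ r ] (m ≤ 3 * r × 3 * r ≤ 2 * m
    × C₀₁ f ≥ length (sup g) / (#[ r ] g * #[ m ∸ r ] g))
theorem8 n f g h m f≈g+h 2≤m g-large h-small =
  let r , (m≤3r , 3r≤2m) , ≤max = argmax-InMiddleThird m 2≤m φ
  -- The bound for counting circuits is applied to one attaining the minimum, with `M` equal to
  -- `φ r`.
  in r , m≤3r , 3r≤2m , λ { _ ((C , counts , refl) , _) → bound C counts ≤max }
  where
  φ : ℕ → ℕ
  φ r = #[ r ] g * #[ m ∸ r ] g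
  sup-large : All (λ T → m ≤ ∣ T ∣) (sup g)
  sup-large = All.tabulate λ T∈ →
    let e , e∈g , e≡T = Supports⇒∈-monomials g (∈-sup⇒Supports g T∈)
    in subst (λ T → m ≤ ∣ T ∣) e≡T (All.lookup g-large e∈g)
  h⇒small : ∀ {T} → Supports h T → 3 * ∣ T ∣ < m
  h⇒small T∈h =
    let e , e∈h , e≡T = Supports⇒∈-monomials h T∈h
    in subst (λ T → 3 * ∣ T ∣ < m) e≡T (All.lookup h-small e∈h)
  f⇒g : ∀ {T} → Supports f T → m ≤ 3 * ∣ T ∣ → T ∈ sup g
  f⇒g T∈f m≤3∣T∣ =
    [ Supports⇒∈-sup g , (λ T∈h → contradiction m≤3∣T∣ (<⇒≱ (h⇒small T∈h))) ]′
      (Any.++⁻ g (Supports-resp-≈ f (g +ₚ h) f≈g+h T∈f))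
  bound : ∀ {M} (C : Circuit n) → Counts C f → (∀ r → InMiddleThird m r → φ r ≤ M) →
          length (sup g) ≤ size C * M
  -- Equality of supports enters in both directions: sets of `g` are produced by `C`, and produced
  -- sets with at least m/3 variables return to `sup g`.
  bound C counts = length≤size C 2≤m (sup-Unique g) sup-large
    (λ S∈ → Supports-resp-eval f (produced C) (sym ∘ counts)
      (Supports-resp-≈ (g +ₚ h) f (sym ∘ f≈g+h) (Any.++⁺ˡ (∈-sup⇒Supports g S∈))))
    (f⇒g ∘ Supports-resp-eval (produced C) f counts)
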